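{- For every constant integer $c\ge 2$ there are $\kappa>0$ and $\varepsilon_0>0$ depending only on $c$ such that for every $n\ge c$ and every $0<\varepsilon\le\varepsilon_0$, the cardinal complexity (with parameter $\varepsilon$) of the $n$-face die guessing game is at least $$\underbrace{2^{2^{\cdot^{\cdot^{\cdot^{\,\kappa/\varepsilon}}}}}}_{c-2\ \text{twos}},$$ i.e. the result of applying $x\mapsto 2^x$ exactly $c-2$ times to $\kappa/\varepsilon$.
   Context: Die guessing game. A die has $n$ faces with $n$ distinct integers from $[N]=\{1,\dots,N\}$ written on them: the adversary picks an $n$-element set $S\subseteq[N]$ and the numbers are assigned to the faces by a uniformly random permutation. The die is rolled (the order of the faces is uniformly random); the algorithm sees the $n-1$ numbers on all faces but the last (hidden) one, and guesses the rank, in $\{1,\dots,n\}$, of the hidden number among the $n$ numbers of $S$. The reward is $1$ if the guess is correct and $0$ otherwise. An ordinal algorithm only sees the relative order of the visible numbers; the best expected reward of an ordinal algorithm is $1/n$. A general (cardinal) algorithm sees the actual values. Algorithms may be randomized. Cardinal complexity. For a parameter $\varepsilon>0$, the cardinal complexity of the game is the minimum $N$ such that there is a distribution $\mathcal{F}$ over $n$-element subsets of $[N]$ for which, when $S\sim\mathcal{F}$, every algorithm (even knowing $\mathcal{F}$) has expected reward at most $(1+\varepsilon)$ times the best expected reward of an ordinal algorithm, i.e. at most $(1+\varepsilon)/n$. -}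

module Defs where

open import Algebra.Bundles using (CommutativeRing)
open import Algebra.Definitions.RawMonoid using (_×_)
open import Data.Fin.Base using (Fin; inject₁; fromℕ)
open import Data.Fin.Permutation as Perm using (Permutation′; _⟨$⟩ʳ_)
open import Data.List.Base using (List; []; _∷_; _++_; map; concatMap; foldr; allFin)
open import Data.List.Membership.Propositional using (_∈_)
import Data.Nat.Base as ℕ
open import Data.Nat.Base using (ℕ; zero; suc)
import Data.Nat.Properties as ℕ
open import Data.Product.Base using (Σ-syntax; ∃-syntax; _,_; proj₂)
  renaming (_×_ to _∧_)
open import Data.Vec.Base using (Vec; []; _∷_; lookup; tabulate)
open import Function.Bundles using (_⇔_; mk⇔)
open import Level using (Level; _⊔_) renaming (suc to lsuc)
open import Relation.Binary.Core using (Rel)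
open import Relation.Binary.Structures using (IsDecTotalOrder)
open import Relation.Nullary.Negation.Core using (¬_)

-- Stands in for ℝ, which the library lacks: classically the models are exactly
-- the subfields of ℝ (ℝ itself included), so a statement about every model
-- contains the statement about real ε and real probabilities.  The order is
-- decidable, as that of ℝ is classically.  The value of 0# ⁻¹ is unspecified.
record ArchimedeanOrderedField (a ℓ₁ ℓ₂ : Level) : Set (lsuc (a ⊔ ℓ₁ ⊔ ℓ₂)) where
  infix  4 _≤_ _<_
  infix  8 _⁻¹
  infixl 7 _/_
  field
    commutativeRing : CommutativeRing a ℓ₁
  open CommutativeRing commutativeRing public
  field
    _≤_             : Rel Carrier ℓ₂
    isDecTotalOrder : IsDecTotalOrder _≈_ _≤_
    0≉1             : ¬ 0# ≈ 1#
    +-monoʳ-≤       : ∀ z {x y} → x ≤ y → z + x ≤ z + y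
    *-nonNegative   : ∀ {x y} → 0# ≤ x → 0# ≤ y → 0# ≤ x * y
    _⁻¹             : Carrier → Carrier
    ⁻¹-cong         : ∀ {x y} → x ≈ y → x ⁻¹ ≈ y ⁻¹
    ⁻¹-inverseʳ     : ∀ {x} → ¬ x ≈ 0# → x * x ⁻¹ ≈ 1#

  _<_ : Rel Carrier (ℓ₁ ⊔ ℓ₂)
  x < y = x ≤ y ∧ ¬ x ≈ y

  _/_ : Carrier → Carrier → Carrier
  x / y = x * y ⁻¹

  fromNat : ℕ → Carrier
  fromNat n = _×_ +-rawMonoid n 1#

  field
    archimedean : ∀ x → ∃[ n ] x ≤ fromNat n

-- A positive real number T, given by the nonnegative rationals below it:
-- T p q means p / (1 + q) < T.  This makes sense of 2 ^ x for x in a field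
-- that need not contain that number.
PosReal : (ℓ : Level) → Set (lsuc ℓ)
PosReal ℓ = (p q : ℕ) → Set ℓ

-- r < 2 ^ T  iff  r < 2 ^ (a / (1 + b)) for some rational a / (1 + b) < T; with
-- r = p / (1 + q), raise both sides to the power 1 + b and clear denominators.
2^_ : ∀ {ℓ} → PosReal ℓ → PosReal ℓ
(2^ T) p q =
  ∃[ a ] ∃[ b ] T a b ∧ p ℕ.^ suc b ℕ.< 2 ℕ.^ a ℕ.* suc q ℕ.^ suc b

twos : ∀ {ℓ} → ℕ → PosReal ℓ → PosReal ℓ
twos zero    T = T
twos (suc k) T = 2^ (twos k T)

infix 4 _≤ℕ_

_≤ℕ_ : ∀ {ℓ} → PosReal ℓ → ℕ → Set ℓ
T ≤ℕ N = ∀ p q → T p q → p ℕ.≤ N ℕ.* suc q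

-- Each n-element subset of the elements of the list (assumed distinct) occurs
-- exactly once, its elements being in the order of the list.
choose : ∀ {a} {A : Set a} (n : ℕ) → List A → List (Vec A n)
choose zero    xs       = [] ∷ []
choose (suc n) []       = []
choose (suc n) (x ∷ xs) = map (x ∷_) (choose n xs) ++ choose (suc n) xs

-- The n-element subsets of an N-element range of integers (here 0,…,N-1), each
-- listed increasingly, so that the element at index r has (0-based) rank r.
subsets : (n N : ℕ) → List (Vec (Fin N) n)
subsets n N = choose n (allFin N)

-- Each of the n! permutations occurs once; the image of the last point is chosen first.
permutations : (n : ℕ) → List (Permutation′ n)
permutations zero    = Perm.id ∷ []
permutations (suc n) =
  concatMap (λ i → map (Perm.insert (fromℕ n) i) (permutations n)) (allFin (suc n))

module _ {a ℓ₁ ℓ₂} (K : ArchimedeanOrderedField a ℓ₁ ℓ₂) where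
  open ArchimedeanOrderedField K

  fromField : Carrier → PosReal (ℓ₁ ⊔ ℓ₂)
  fromField x p q = fromNat p < fromNat (suc q) * x

  ∑ : ∀ {b} {A : Set b} → List A → (A → Carrier) → Carrier
  ∑ xs f = foldr (λ x s → f x + s) 0# xs

  -- A probability distribution on the members of a list without repetitions.
  -- Weights of elements outside the list are irrelevant.
  record Distribution {b} {A : Set b} (xs : List A) : Set (a ⊔ b ⊔ ℓ₁ ⊔ ℓ₂) where
    field
      weight      : A → Carrier
      nonNegative : ∀ {x} → x ∈ xs → 0# ≤ weight x
      total       : ∑ xs weight ≈ 1#

  open Distribution public

  -- The game with n = suc m faces, the last of which is hidden.

  -- A randomized algorithm: from the m visible numbers to a random guess, a
  -- rank being counted from 0.
  Algorithm : (m N : ℕ) → Set (a ⊔ ℓ₁ ⊔ ℓ₂)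
  Algorithm m N = Vec (Fin N) m → Distribution (allFin (suc m))

  -- Under the permutation π, face j shows the number of rank π j in S.
  visible : ∀ {m N} → Vec (Fin N) (suc m) → Permutation′ (suc m) → Vec (Fin N) m
  visible S π = tabulate (λ j → lookup S (π ⟨$⟩ʳ inject₁ j))

  hiddenRank : ∀ {m} → Permutation′ (suc m) → Fin (suc m)
  hiddenRank {m} π = π ⟨$⟩ʳ fromℕ m

  -- The expected reward for a given set S, over a uniformly random permutation
  -- and the randomness of the algorithm: the expectation of the 0/1 reward is
  -- the probability that the algorithm guesses the hidden rank.
  rewardOn : ∀ {m N} → Algorithm m N → Vec (Fin N) (suc m) → Carrier
  rewardOn {m} A S =
    ∑ (permutations (suc m)) (λ π → weight (A (visible S π)) (hiddenRank π))
      / fromNat (suc m ℕ.!)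

  expectedReward : ∀ {m N} → Distribution (subsets (suc m) N) → Algorithm m N → Carrier
  expectedReward {m} {N} F A = ∑ (subsets (suc m) N) (λ S → weight F S * rewardOn A S)

  -- Some distribution over the (suc m)-element subsets of [N] holds every
  -- algorithm to (1 + ε) times the optimal ordinal reward 1 / (suc m).
  Feasible : (m : ℕ) (ε : Carrier) (N : ℕ) → Set (a ⊔ ℓ₁ ⊔ ℓ₂)
  Feasible m ε N =
    Σ[ F ∈ Distribution (subsets (suc m) N) ]
      (∀ (A : Algorithm m N) → expectedReward F A ≤ (1# + ε) / fromNat (suc m))

  IsCardinalComplexity : (m : ℕ) (ε : Carrier) (N : ℕ) → Set (a ⊔ ℓ₁ ⊔ ℓ₂)
  IsCardinalComplexity m ε N = Feasible m ε N ∧ (∀ M → Feasible m ε M → N ℕ.≤ M)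

  -- The minimum of the feasible N is at least T.  Stated without presupposing
  -- that the minimum exists (a set without a minimum, necessarily empty, counts
  -- as having minimum ∞).
  CardinalComplexity≥ : ∀ {ℓ} (m : ℕ) (ε : Carrier) → PosReal ℓ → Set (a ⊔ ℓ₁ ⊔ ℓ₂ ⊔ ℓ)
  CardinalComplexity≥ m ε T = ∀ N → Feasible m ε N → T ≤ℕ N

  cardinalComplexity≥⇔ : ∀ {ℓ m ε N} {T : PosReal ℓ} →
    IsCardinalComplexity m ε N → CardinalComplexity≥ m ε T ⇔ T ≤ℕ N
  cardinalComplexity≥⇔ {N = N} (feasible , least) = mk⇔
    (λ bound → bound N feasible)
    (λ T≤N M feasibleM p q below →
      ℕ.≤-trans (T≤N p q below) (ℕ.*-monoˡ-≤ (suc q) (least M feasibleM)))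

{-# OPTIONS --safe #-}

-- Guessing only among the ranks of the c lowest numbers reduces n ≥ c faces to n = c, so it
-- suffices to have, for c faces and numbers below a tower of c - 2 twos with M on top, a rule
-- whose reward is (1 + 1 / D) / c on every set, where D = O(M); feasibility then forces 1 ≤ D ε.
--
-- For c = 2, guess rank 0 with probability x / M upon seeing x.  The tower is raised as in the
-- stepping-up lemma of Erdős and Hajnal: numbers x₁ < … < x_c below 2 ^ b have gaps δᵢ < b, the
-- positions of the highest binary digits where xᵢ and xᵢ₊₁ differ.  Neighbouring gaps are
-- distinct, and hiding a number merges the gaps beside it into their maximum.  If the gaps are
-- monotone, hiding a number therefore deletes one gap, and the rule for c - 1 numbers below b
-- applies.  Otherwise three successive gaps, those of a window of four numbers, are not monotone;
-- there a rule that only looks at the order of two gaps gains a constant factor.  Averaging it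
-- over all windows loses nothing when the gaps are monotone, so a mixture of the two rules gains
-- in both cases.
module Submission where

open import Defs
open import Data.Bool.Base using (Bool; true; false; if_then_else_)
open import Data.Fin.Base using (Fin; zero; suc; toℕ; fromℕ; inject₁; punchIn)
open import Data.Fin.Permutation as Perm using (Permutation′; _⟨$⟩ʳ_)
open import Data.Fin.Properties using (toℕ<n) renaming (_≟_ to _≟ᶠ_)
open import Data.List.Base
  using (List; []; _∷_; _++_; length; map; take; tabulate; allFin; concatMap)
open import Data.List.Membership.Propositional using (_∈_)
open import Data.List.Membership.Propositional.Properties using (∈-++⁻; ∈-map⁻)
open import Data.List.Properties
  using (length-map; length-take; length-++; length-tabulate; tabulate-cong)
open import Data.List.Relation.Binary.Permutation.Propositional
  using (_↭_; ↭-refl; ↭-sym; ↭-trans; ↭-prep; ↭-swap; ↭-reflexive; ↭⇒↭ₛ)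
open import Data.List.Relation.Binary.Permutation.Propositional.Properties using (↭-length)
open import Data.List.Relation.Binary.Pointwise using (Pointwise-≡⇒≡)
open import Data.List.Relation.Binary.Sublist.Propositional
  using (_⊆_; []; _∷_; _∷ʳ_; ⊆-refl; minimum)
open import Data.List.Relation.Binary.Sublist.Propositional.Properties using (All-resp-⊆)
open import Data.List.Relation.Unary.All using (All; []; _∷_)
open import Data.List.Relation.Unary.AllPairs as AllPairs using (AllPairs; []; _∷_)
import Data.List.Relation.Unary.AllPairs.Properties as AllPairs
open import Data.List.Relation.Unary.Any using (here; there)
open import Data.List.Relation.Unary.Linked as Linked using (Linked; []; [-]; _∷_)
import Data.List.Relation.Unary.Linked.Properties as Linked
open import Data.List.Relation.Unary.Sorted.TotalOrder.Properties using (↗↭↗⇒≋)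
import Data.Nat.Base as ℕ
open import Data.Nat.Base using (ℕ; zero; suc; _∸_; z≤n; s≤s; _!) renaming (_≤_ to _≤ⁿ_)
import Data.Nat.Properties as ℕ
open import Data.List.Sort ℕ.≤-decTotalOrder using (sortingAlgorithm; module SortingAlgorithm)
open import Data.Nat.Solver using (module +-*-Solver)
open import Data.Product.Base using (Σ-syntax; _×_; _,_; proj₁; proj₂)
open import Data.Sum.Base using (_⊎_; inj₁; inj₂)
open import Data.Vec.Base using (Vec; []; _∷_; lookup; toList)
open import Data.Vec.Properties using (lookup∘tabulate)
open import Function.Base using (_∘_; id)
open import Level using (Level)
open import Relation.Binary.Bundles using (Poset)
open import Relation.Binary.Core using (Rel)
open import Relation.Binary.PropositionalEquality as ≡ using (_≡_)
open import Relation.Binary.Structures using (IsDecTotalOrder)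
open import Relation.Nullary.Decidable using (yes; no; does; dec-true; dec-false)
open import Relation.Nullary.Negation using (¬_; contradiction)

-- Guessing rules and their scores.

module Rules where
  open import Data.Nat.Base
  open import Data.Nat.Properties
  open import Relation.Binary.PropositionalEquality
  open import Algebra.Properties.CommutativeSemigroup +-commutativeSemigroup using (interchange)

  tot : (ℕ → ℕ) → ℕ → ℕ
  tot f zero    = 0
  tot f (suc n) = f 0 + tot (f ∘ suc) n

  tot-zero : ∀ n → tot (λ _ → 0) n ≡ 0
  tot-zero zero    = refl
  tot-zero (suc n) = tot-zero n

  tot-+ : ∀ f g n → tot (λ r → f r + g r) n ≡ tot f n + tot g n
  tot-+ f g zero    = refl
  tot-+ f g (suc n) = trans (cong (f 0 + g 0 +_) (tot-+ (f ∘ suc) (g ∘ suc) n))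
    (interchange (f 0) (g 0) (tot (f ∘ suc) n) (tot (g ∘ suc) n))

  tot-* : ∀ a f n → tot (λ r → a * f r) n ≡ a * tot f n
  tot-* a f zero    = sym (*-zeroʳ a)
  tot-* a f (suc n) = trans (cong (a * f 0 +_) (tot-* a (f ∘ suc) n))
    (sym (*-distribˡ-+ a (f 0) (tot (f ∘ suc) n)))

  -- Pads a rule for few faces to more ranks. The recursion on both numbers makes it commute with
  -- `peel` by computation, as the inductions on `score` require.
  guard : ℕ → (ℕ → ℕ) → ℕ → ℕ
  guard zero    f r       = 0
  guard (suc k) f zero    = f 0
  guard (suc k) f (suc r) = guard k (f ∘ suc) r

  tot-guard : ∀ k {n} f → k ≤ n → tot (guard k f) n ≡ tot f k
  tot-guard zero    {n} f k≤n       = tot-zero n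
  tot-guard (suc k)     f (s≤s k≤n) = cong (f 0 +_) (tot-guard k (f ∘ suc) k≤n)

  -- Maps the sorted visible numbers to the unnormalised probabilities of the ranks 0, 1, ….
  Rule : Set
  Rule = List ℕ → ℕ → ℕ

  -- What is left of `w` once the lowest number is known to be the visible `x`; this makes `score`
  -- structurally recursive.
  peel : ℕ → Rule → Rule
  peel x w y r = w (x ∷ y) (suc r)

  -- The sum over r of w (S without its entry of rank r) r.
  score : Rule → List ℕ → ℕ
  score w []       = 0
  score w (x ∷ xs) = w xs 0 + score (peel x w) xs

  -- A score depends on a rule only at the lists left by hiding one entry, so rules need only be
  -- compared there.
  data Removal {a} {A : Set a} : List A → List A → Set a where
    here  : ∀ {x xs} → Removal (x ∷ xs) xs
    there : ∀ {x xs ys} → Removal xs ys → Removal (x ∷ xs) (x ∷ ys)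

  score-mono : ∀ {u w} S → (∀ {y} → Removal S y → ∀ r → u y r ≤ w y r) → score u S ≤ score w S
  score-mono []       u≤w = z≤n
  score-mono (x ∷ xs) u≤w = +-mono-≤ (u≤w here 0) (score-mono xs (λ rem r → u≤w (there rem) (suc r)))

  score-zero : ∀ S → score (λ _ _ → 0) S ≡ 0
  score-zero []       = refl
  score-zero (x ∷ xs) = score-zero xs

  score-+ : ∀ u w S → score (λ y r → u y r + w y r) S ≡ score u S + score w S
  score-+ u w []       = refl
  score-+ u w (x ∷ xs) = trans (cong (u xs 0 + w xs 0 +_) (score-+ (peel x u) (peel x w) xs))
    (interchange (u xs 0) (w xs 0) (score (peel x u) xs) (score (peel x w) xs))

  score-* : ∀ a w S → score (λ y r → a * w y r) S ≡ a * score w S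
  score-* a w []       = sym (*-zeroʳ a)
  score-* a w (x ∷ xs) = trans (cong (a * w xs 0 +_) (score-* a (peel x w) xs))
    (sym (*-distribˡ-+ a (w xs 0) (score (peel x w) xs)))

  score-map : ∀ f w S → score (λ y → w (map f y)) S ≡ score w (map f S)
  score-map f w []       = refl
  score-map f w (x ∷ xs) = cong (w (map f xs) 0 +_) (score-map f (peel (f x) w) xs)

  score-guard : ∀ k w S → length S ≤ k → score (λ y → guard k (w y)) S ≡ score w S
  score-guard k       w []       _           = refl
  score-guard (suc k) w (x ∷ xs) (s≤s xs≤k) = cong (w xs 0 +_) (score-guard k (peel x w) xs xs≤k)

  truncate : ℕ → Rule → Rule
  truncate k w y = guard (suc k) (w (take k y))

  -- Hiding one of the `k + 1` lowest numbers leaves the other `k` as the lowest visible ones;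
  -- hiding any higher number earns nothing, because `guard` cuts off its rank.
  score-truncate : ∀ k w S → score (truncate k w) S ≡ score w (take (suc k) S)
  score-truncate k       w []       = refl
  score-truncate zero    w (x ∷ xs) = cong (w [] 0 +_) (score-zero xs)
  score-truncate (suc k) w (x ∷ xs) = cong (w (take (suc k) xs) 0 +_) (score-truncate k (peel x w) xs)

  infix 4 _<[_]_

  _<[_]_ : ℕ → ℕ → ℕ → Set
  x <[ N ] y = x < y × y < N

  -- For a die with k + 1 faces whose numbers S, listed increasingly, are below N.  All
  -- probabilities are scaled by D; the score of an ordinal rule would be D.
  record Beats (k N D : ℕ) : Set where
    field
      rule  : Rule
      total : ∀ y → length y ≡ k → tot (rule y) (suc k) ≡ D
      gain  : ∀ S → length S ≡ suc k → Linked _<[ N ]_ S → suc D ≤ score rule S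

  open Beats

  -- Two faces.

  module Threshold (M : ℕ) where
    -- M ∸ (M ∸ x) is x for x ≤ M, and makes the weights add up to M for every x.
    guess : Rule
    guess (x ∷ _) 0 = M ∸ (M ∸ x)
    guess (x ∷ _) 1 = M ∸ x
    guess _       _ = 0

    beats : Beats 1 M M
    rule  beats = guess
    total beats (x ∷ []) _ = trans (cong (M ∸ (M ∸ x) +_) (+-identityʳ _)) (m∸n+n≡m (m∸n≤m M x))
    -- Hiding `x` earns `y` and hiding `y` earns `M ∸ x`, together `M + (y ∸ x)`.
    gain  beats (x ∷ y ∷ []) _ ((x<y , y<M) ∷ _) = begin
      suc M                          ≡⟨ cong suc (m∸n+n≡m (<⇒≤ (<-trans x<y y<M))) ⟨
      suc (M ∸ x + x)                ≡⟨ +-suc (M ∸ x) x ⟨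
      M ∸ x + suc x                  ≤⟨ +-monoʳ-≤ (M ∸ x) x<y ⟩
      M ∸ x + y                      ≡⟨ +-comm (M ∸ x) y ⟩
      y + (M ∸ x)                    ≡⟨ cong (_+ (M ∸ x)) (m∸[m∸n]≡n (<⇒≤ y<M)) ⟨
      M ∸ (M ∸ y) + (M ∸ x)          ≡⟨ cong (M ∸ (M ∸ y) +_) (+-identityʳ (M ∸ x)) ⟨
      M ∸ (M ∸ y) + (M ∸ x + 0)      ∎
      where open ≤-Reasoning

  -- Gaps between binary numbers.

  -- The position of the highest binary digit in which the distinct x, y < 2 ^ b differ.
  gap : ℕ → ℕ → ℕ → ℕ
  gap zero    x y = 0
  gap (suc b) x y with ⌊ x /2⌋ ≟ ⌊ y /2⌋
  ... | yes _ = 0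
  ... | no  _ = suc (gap b ⌊ x /2⌋ ⌊ y /2⌋)

  -- The index is the maximum of the two gaps, and the constructor tells which one attains it; equal
  -- neighbouring gaps are excluded.
  data Merge (d e : ℕ) : ℕ → Set where
    up   : d < e → Merge d e e
    down : e < d → Merge d e d

  ⌊m/2⌋<n : ∀ m n → m < 2 * n → ⌊ m /2⌋ < n
  ⌊m/2⌋<n zero          (suc n) m<2n = z<s
  ⌊m/2⌋<n (suc zero)    (suc n) m<2n = z<s
  ⌊m/2⌋<n (suc (suc m)) (suc n) m<2n =
    s≤s (⌊m/2⌋<n m n (≤-pred (≤-pred (subst (suc (suc m) <_) (*-suc 2 n) m<2n))))

  ⌊/2⌋-separates : ∀ {x y z} → x < y → y < z → ⌊ x /2⌋ < ⌊ z /2⌋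
  ⌊/2⌋-separates x<y y<z = ⌊n/2⌋-mono (≤-trans (s≤s x<y) y<z)

  ⌊/2⌋-< : ∀ {x y} → x < y → ⌊ x /2⌋ ≢ ⌊ y /2⌋ → ⌊ x /2⌋ < ⌊ y /2⌋
  ⌊/2⌋-< x<y h≢ = ≤∧≢⇒< (⌊n/2⌋-mono (<⇒≤ x<y)) h≢

  -- Induction on the number of digits, dropping the lowest. The halves of `x` and `z` differ, so at
  -- most one neighbouring pair shares its half. Such a pair has gap 0, and the other pair has the
  -- halves of `x` and `z`, hence the same positive gap. If no pair shares its half, the claim
  -- passes to the halves.
  gap-merge : ∀ b {x y z} → x < y → y < z → z < 2 ^ b → Merge (gap b x y) (gap b y z) (gap b x z)
  gap-merge zero    x<y y<z (s≤s z≤n) = contradiction y<z λ ()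
  gap-merge (suc b) {x} {y} {z} x<y y<z z<2^b
    with ⌊ x /2⌋ ≟ ⌊ y /2⌋ | ⌊ y /2⌋ ≟ ⌊ z /2⌋ | ⌊ x /2⌋ ≟ ⌊ z /2⌋
  ... | _       | _       | yes x≡z = contradiction x≡z (<⇒≢ (⌊/2⌋-separates x<y y<z))
  ... | yes x≡y | yes y≡z | no x≢z  = contradiction (trans x≡y y≡z) x≢z
  ... | yes x≡y | no _    | no _    rewrite x≡y = up z<s
  ... | no _    | yes y≡z | no _    rewrite y≡z = down z<s
  ... | no x≢y  | no y≢z  | no _
    with gap b ⌊ x /2⌋ ⌊ z /2⌋
       | gap-merge b (⌊/2⌋-< x<y x≢y) (⌊/2⌋-< y<z y≢z) (⌊m/2⌋<n z (2 ^ b) z<2^b)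
  ... | _ | up d<e   = up (s≤s d<e)
  ... | _ | down e<d = down (s≤s e<d)

  gap< : ∀ b {x y} → x < y → y < 2 ^ b → gap b x y < b
  gap< zero    x<y (s≤s z≤n) = contradiction x<y λ ()
  gap< (suc b) {x} {y} x<y y<2^b with ⌊ x /2⌋ ≟ ⌊ y /2⌋
  ... | yes _  = z<s
  ... | no x≢y = s≤s (gap< b (⌊/2⌋-< x<y x≢y) (⌊m/2⌋<n y (2 ^ b) y<2^b))

  -- Gap sequences of increasing numbers.

  module SteppingUp (b : ℕ) where

    δ : ℕ → ℕ → ℕ
    δ = gap b

    Increasing : List ℕ → Set
    Increasing = Linked _<[ 2 ^ b ]_

    merge : ∀ {x y z} → x <[ 2 ^ b ] y → y <[ 2 ^ b ] z → Merge (δ x y) (δ y z) (δ x z)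
    merge (x<y , _) (y<z , z<2^b) = gap-merge b x<y y<z z<2^b

    merge-up : ∀ {d e f} → d < e → Merge d e f → f ≡ e
    merge-up d<e (up _)     = refl
    merge-up d<e (down e<d) = contradiction e<d (<-asym d<e)

    merge-down : ∀ {d e f} → e < d → Merge d e f → f ≡ d
    merge-down e<d (down _) = refl
    merge-down e<d (up d<e) = contradiction d<e (<-asym e<d)

    gapsFrom : ℕ → List ℕ → List ℕ
    gapsFrom x []       = []
    gapsFrom x (y ∷ ys) = δ x y ∷ gapsFrom y ys

    gaps : List ℕ → List ℕ
    gaps []       = []
    gaps (x ∷ xs) = gapsFrom x xs

    length-gapsFrom : ∀ x ys → length (gapsFrom x ys) ≡ length ys
    length-gapsFrom x []       = refl
    length-gapsFrom x (y ∷ ys) = cong suc (length-gapsFrom y ys)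

    -- With increasing gaps, the gap that vanishes with a number is the one to its left.
    score-up : ∀ w x xs → Increasing (x ∷ xs) → Linked _<_ (gapsFrom x xs) →
               score (λ ys → w (gapsFrom x ys)) xs ≡ score w (gapsFrom x xs)
    score-up w x []           _           _          = refl
    score-up w x (y ∷ [])     _           _          = refl
    score-up w x (y ∷ z ∷ zs) (x<y ∷ y<z ∷ inc) (d<e ∷ ups)
      rewrite merge-up d<e (merge x<y y<z) =
      cong (w (gapsFrom y (z ∷ zs)) 0 +_) (score-up (peel (δ x y) w) y (z ∷ zs) (y<z ∷ inc) ups)

    -- With decreasing gaps, it is the one to its right.
    score-down : ∀ w x xs → Increasing (x ∷ xs) → Linked _>_ (gapsFrom x xs) →
                 score w (gapsFrom x xs) ≤ score (λ y → w (gaps y)) (x ∷ xs)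
    score-down w x []           _ _ = z≤n
    score-down w x (y ∷ [])     _ _ = +-monoʳ-≤ (w [] 0) z≤n
    score-down w x (y ∷ z ∷ zs) (x<y ∷ y<z ∷ inc) (d>e ∷ downs)
      rewrite merge-down d>e (merge x<y y<z) =
      +-monoʳ-≤ (w (gapsFrom y (z ∷ zs)) 0) (score-down (peel (δ x y) w) y (z ∷ zs) (y<z ∷ inc) downs)

    -- A single visible gap tells nothing of monotonicity, so c = 3 needs a rule of its own.
    module ThreeFaces where
      -- Hiding the middle number shows the larger of the two gaps, hiding an outer number shows the
      -- gap on the other side; so a large visible gap speaks for rank 1. The score is `2 * b` plus
      -- the difference of the two gaps. The double subtraction again keeps the total constant.
      guess : Rule
      guess (x ∷ y ∷ _) 0 = b ∸ δ x y
      guess (x ∷ y ∷ _) 1 = 2 * (b ∸ (b ∸ δ x y))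
      guess (x ∷ y ∷ _) 2 = b ∸ δ x y
      guess _           _ = 0

      split : ∀ {a} → a ≤ b → a + (2 * (b ∸ a) + (a + 0)) ≡ 2 * b
      split {a} a≤b = begin
        a + (2 * (b ∸ a) + (a + 0))
          ≡⟨ solve 2 (λ a c → a :+ (con 2 :* c :+ (a :+ con 0)) := con 2 :* (a :+ c)) refl a (b ∸ a) ⟩
        2 * (a + (b ∸ a))           ≡⟨ cong (2 *_) (m+[n∸m]≡n a≤b) ⟩
        2 * b                       ∎
        where
        open ≡-Reasoning
        open +-*-Solver

      split< : ∀ {d e} → d < e → e ≤ b → 2 * b < (b ∸ e) + (2 * (b ∸ (b ∸ e)) + (b ∸ d))
      split< {d} {e} d<e e≤b = begin-strict
        2 * b                                         ≡⟨ split (m∸n≤m b e) ⟨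
        (b ∸ e) + (2 * (b ∸ (b ∸ e)) + (b ∸ e + 0))
          ≡⟨ cong (λ t → (b ∸ e) + (2 * (b ∸ (b ∸ e)) + t)) (+-identityʳ (b ∸ e)) ⟩
        (b ∸ e) + (2 * (b ∸ (b ∸ e)) + (b ∸ e))
          <⟨ +-monoʳ-< (b ∸ e) (+-monoʳ-< (2 * (b ∸ (b ∸ e))) (∸-monoʳ-< d<e e≤b)) ⟩
        (b ∸ e) + (2 * (b ∸ (b ∸ e)) + (b ∸ d))       ∎
        where open ≤-Reasoning

      beats : Beats 2 (2 ^ b) (2 * b)
      rule  beats = guess
      total beats (x ∷ y ∷ []) _ = split (m∸n≤m b (δ x y))
      gain  beats (x ∷ y ∷ z ∷ []) _ (x<y ∷ y<z ∷ _)
        with δ x z | merge x<y y<z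
      ... | _ | up d<e rewrite +-identityʳ (b ∸ δ x y) =
        split< d<e (<⇒≤ (gap< b (proj₁ y<z) (proj₂ y<z)))
      ... | _ | down e<d rewrite +-identityʳ (b ∸ δ x y) = begin-strict
        2 * b <⟨ split< e<d (<⇒≤ (gap< b (proj₁ x<y) (proj₂ x<y))) ⟩
        (b ∸ δ x y) + (2 * (b ∸ (b ∸ δ x y)) + (b ∸ δ y z))
          ≡⟨ solve 3 (λ p q r → p :+ (q :+ r) := r :+ (q :+ p)) refl (b ∸ δ x y) (2 * (b ∸ (b ∸ δ x y))) (b ∸ δ y z) ⟩
        (b ∸ δ y z) + (2 * (b ∸ (b ∸ δ x y)) + (b ∸ δ x y)) ∎
        where
        open ≤-Reasoning
        open +-*-Solver

    -- The window rule.

    rises : List ℕ → Bool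
    rises (x ∷ y ∷ z ∷ _) = does (δ x y <? δ y z)
    rises _               = false

    rises-true : ∀ {x y z} zs → δ x y < δ y z → rises (x ∷ y ∷ z ∷ zs) ≡ true
    rises-true zs = dec-true (_ <? _)

    rises-false : ∀ {x y z} zs → δ y z < δ x y → rises (x ∷ y ∷ z ∷ zs) ≡ false
    rises-false zs = dec-false (_ <? _) ∘ <-asym

    -- For four numbers the gaps d, e, f score 1 + 4 if d < e < f, 4 + 1 if d > e > f, 4 + 4 if
    -- d < e > f, and 1 + 4 + 1 if d > e < f (where the order of d and f does not matter).
    afterUp afterDown : ℕ → ℕ
    afterUp 0 = 1
    afterUp 2 = 4
    afterUp _ = 0
    afterDown 1 = 4
    afterDown 3 = 1
    afterDown _ = 0

    four : Rule
    four y = if rises y then afterUp else afterDown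

    tot-four : ∀ y n → tot (four y) (4 + n) ≡ 5
    tot-four y n with rises y
    ... | true  = cong (5 +_) (tot-zero n)
    ... | false = cong (5 +_) (tot-zero n)

    module _ {x₁ x₂ x₃ x₄ xs} (inc : Increasing (x₁ ∷ x₂ ∷ x₃ ∷ x₄ ∷ xs)) where

      private
        x₁<x₂ = Linked.head inc
        x₂<x₃ = Linked.head (Linked.tail inc)
        x₃<x₄ = Linked.head (Linked.tail (Linked.tail inc))
        m₁₃   = merge x₁<x₂ x₂<x₃
        m₂₄   = merge x₂<x₃ x₃<x₄

      module _ (d<e : δ x₁ x₂ < δ x₂ x₃) (e<f : δ x₂ x₃ < δ x₃ x₄) where
        private
          r₁ : rises (x₂ ∷ x₃ ∷ x₄ ∷ xs) ≡ true
          r₁ = rises-true xs e<f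
          r₂ : rises (x₁ ∷ x₃ ∷ x₄ ∷ xs) ≡ true
          r₂ = rises-true xs (subst (_< _) (sym (merge-up d<e m₁₃)) e<f)
          r₃ : rises (x₁ ∷ x₂ ∷ x₄ ∷ xs) ≡ true
          r₃ = rises-true xs (subst (_ <_) (sym (merge-up e<f m₂₄)) (<-trans d<e e<f))
          r₄ : ∀ ys → rises (x₁ ∷ x₂ ∷ x₃ ∷ ys) ≡ true
          r₄ ys = rises-true ys d<e

        -- Whichever number is hidden, two of the three leading gaps survive at the front in their
        -- order. The direction of monotone gaps can therefore be read off the visible numbers,
        -- which is how `monotone` chooses its branch.
        rises-up : ∀ {y} → Removal (x₁ ∷ x₂ ∷ x₃ ∷ x₄ ∷ xs) y → rises y ≡ true
        rises-up here                                = r₁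
        rises-up (there here)                        = r₂
        rises-up (there (there here))                = r₃
        rises-up (there (there (there {ys = ys} _))) = r₄ ys

        four-up : 5 ≤ score four (x₁ ∷ x₂ ∷ x₃ ∷ x₄ ∷ xs)
        four-up rewrite r₁ | r₂ | r₃ | r₄ xs = m≤m+n 5 _

      module _ (e<d : δ x₂ x₃ < δ x₁ x₂) (f<e : δ x₃ x₄ < δ x₂ x₃) where
        private
          r₁ : rises (x₂ ∷ x₃ ∷ x₄ ∷ xs) ≡ false
          r₁ = rises-false xs f<e
          r₂ : rises (x₁ ∷ x₃ ∷ x₄ ∷ xs) ≡ false
          r₂ = rises-false xs (subst (_ <_) (sym (merge-down e<d m₁₃)) (<-trans f<e e<d))
          r₃ : rises (x₁ ∷ x₂ ∷ x₄ ∷ xs) ≡ false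
          r₃ = rises-false xs (subst (_< _) (sym (merge-down f<e m₂₄)) e<d)
          r₄ : ∀ ys → rises (x₁ ∷ x₂ ∷ x₃ ∷ ys) ≡ false
          r₄ ys = rises-false ys e<d

        rises-down : ∀ {y} → Removal (x₁ ∷ x₂ ∷ x₃ ∷ x₄ ∷ xs) y → rises y ≡ false
        rises-down here                                = r₁
        rises-down (there here)                        = r₂
        rises-down (there (there here))                = r₃
        rises-down (there (there (there {ys = ys} _))) = r₄ ys

        four-down : 5 ≤ score four (x₁ ∷ x₂ ∷ x₃ ∷ x₄ ∷ xs)
        four-down rewrite r₁ | r₂ | r₃ | r₄ xs = m≤m+n 5 _

      four-peak : δ x₁ x₂ < δ x₂ x₃ → δ x₃ x₄ < δ x₂ x₃ → 6 ≤ score four (x₁ ∷ x₂ ∷ x₃ ∷ x₄ ∷ xs)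
      four-peak d<e f<e
        rewrite rises-false xs f<e
              | rises-false {x₁} xs (subst (_ <_) (sym (merge-up d<e m₁₃)) f<e)
              | rises-true {z = x₄} xs (subst (_ <_) (sym (merge-down f<e m₂₄)) d<e)
              | rises-true xs d<e = m≤m+n 6 _

      four-valley : δ x₂ x₃ < δ x₁ x₂ → δ x₂ x₃ < δ x₃ x₄ → 6 ≤ score four (x₁ ∷ x₂ ∷ x₃ ∷ x₄ ∷ xs)
      four-valley e<d e<f
        rewrite rises-true xs e<f | rises-false xs e<d
              | merge-down e<d m₁₃ | merge-up e<f m₂₄
        -- Hiding rank 1 and hiding rank 2 leave the same two leading gaps, so either answer pays 4
        -- for exactly one of the two.
        with does (δ x₁ x₂ <? δ x₃ x₄)
      ... | true  = m≤m+n 6 _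
      ... | false = m≤m+n 6 _

    -- Plays `w` on all numbers but the lowest. As rank 0 gets no weight, the score on `x ∷ S` is by
    -- computation that of `w` on `S`.
    shift : Rule → Rule
    shift w y       zero    = 0
    shift w []      (suc r) = 0
    shift w (x ∷ y) (suc r) = w y r

    windows : ℕ → Rule
    windows zero    y r = 0
    windows (suc n) y r = four y r + shift (windows n) y r

    tot-windows : ∀ n y → length y ≡ 2 + n → tot (windows n y) (3 + n) ≡ 5 * n
    tot-windows zero    y _ = refl
    tot-windows (suc n) (x ∷ y) eq = begin
      tot (windows (suc n) (x ∷ y)) (4 + n)
        ≡⟨ tot-+ (four (x ∷ y)) (shift (windows n) (x ∷ y)) (4 + n) ⟩
      tot (four (x ∷ y)) (4 + n) + tot (windows n y) (3 + n)
        ≡⟨ cong₂ _+_ (tot-four (x ∷ y) n) (tot-windows n y (suc-injective eq)) ⟩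
      5 + 5 * n                                                              ≡⟨ *-suc 5 n ⟨
      5 * suc n                                                              ∎
      where open ≡-Reasoning

    -- With monotone gaps the windows only have to lose nothing, since the gain comes from the rule
    -- one level below; otherwise they must gain at least 1 themselves.
    data Shape (n : ℕ) (S : List ℕ) : Set where
      allUp   : Linked _<_ (gaps S) → 5 * n ≤ score (windows n) S → Shape n S
      allDown : Linked _>_ (gaps S) → 5 * n ≤ score (windows n) S → Shape n S
      mixed   : 5 * n < score (windows n) S → Shape n S

    score-windows : ∀ n x S → score (windows (suc n)) (x ∷ S) ≡ score four (x ∷ S) + score (windows n) S
    score-windows n x S = score-+ four (shift (windows n)) (x ∷ S)

    -- Here `m` and `k` are the excesses over the ordinal score, 5 per window, of the first window
    -- and of the remaining ones.
    add-window : ∀ m k n x S → m + 5 ≤ score four (x ∷ S) → k + 5 * n ≤ score (windows n) S →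
                 m + k + 5 * suc n ≤ score (windows (suc n)) (x ∷ S)
    add-window m k n x S p q = begin
      m + k + 5 * suc n                       ≡⟨ cong (m + k +_) (*-suc 5 n) ⟩
      m + k + (5 + 5 * n)                     ≡⟨ interchange m k 5 (5 * n) ⟩
      m + 5 + (k + 5 * n)                     ≤⟨ +-mono-≤ p q ⟩
      score four (x ∷ S) + score (windows n) S ≡⟨ score-windows n x S ⟨
      score (windows (suc n)) (x ∷ S)         ∎
      where open ≤-Reasoning

    shape-≥ : ∀ {n S} → Shape n S → 5 * n ≤ score (windows n) S
    shape-≥ (allUp _ p)   = p
    shape-≥ (allDown _ p) = p
    shape-≥ (mixed p)     = <⇒≤ p

    merge-cases : ∀ {d e f} → Merge d e f → d < e ⊎ e < d
    merge-cases (up d<e)   = inj₁ d<e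
    merge-cases (down e<d) = inj₂ e<d

    -- Induction by adding a lowest number. If the first three gaps turn, the first window gains and
    -- the others lose nothing. If they do not, the first window loses nothing and the shape of the
    -- tail is kept: it shares two gaps with the first window, so its direction, if it has one,
    -- agrees. Three numbers have two gaps, always monotone, and no window.
    shape : ∀ n S → length S ≡ 3 + n → Increasing S → Shape n S
    shape zero (x ∷ y ∷ z ∷ []) _ (x<y ∷ y<z ∷ _) with merge-cases (merge x<y y<z)
    ... | inj₁ d<e = allUp   (d<e ∷ [-]) z≤n
    ... | inj₂ e<d = allDown (e<d ∷ [-]) z≤n
    shape (suc n) (x ∷ S@(_ ∷ _ ∷ _ ∷ _)) eq inc@(x₁<x₂ ∷ inc′@(x₂<x₃ ∷ x₃<x₄ ∷ _))
      with merge-cases (merge x₁<x₂ x₂<x₃) | merge-cases (merge x₂<x₃ x₃<x₄)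
         | shape n S (suc-injective eq) inc′
    ... | inj₁ d<e | inj₁ e<f | allUp ups p = allUp (d<e ∷ ups) (add-window 0 0 n x S (four-up inc d<e e<f) p)
    ... | inj₁ d<e | inj₁ e<f | allDown (f<e ∷ _) p = contradiction e<f (<-asym f<e)
    ... | inj₁ d<e | inj₁ e<f | mixed p = mixed (add-window 0 1 n x S (four-up inc d<e e<f) p)
    ... | inj₁ d<e | inj₂ f<e | s = mixed (add-window 1 0 n x S (four-peak inc d<e f<e) (shape-≥ s))
    ... | inj₂ e<d | inj₁ e<f | s = mixed (add-window 1 0 n x S (four-valley inc e<d e<f) (shape-≥ s))
    ... | inj₂ e<d | inj₂ f<e | allUp (e<f ∷ _) p = contradiction e<f (<-asym f<e)
    ... | inj₂ e<d | inj₂ f<e | allDown downs p = allDown (e<d ∷ downs)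
      (add-window 0 0 n x S (four-down inc e<d f<e) p)
    ... | inj₂ e<d | inj₂ f<e | mixed p = mixed (add-window 0 1 n x S (four-down inc e<d f<e) p)

    -- Turns decreasing gaps into increasing ones without moving them.
    flip : ℕ → ℕ
    flip d = b ∸ suc d

    flip-decreasing : ∀ {G} → All (_< b) G → Linked _>_ G → Linked _<[ b ]_ (map flip G)
    flip-decreasing _                      []               = []
    flip-decreasing _                      [-]              = [-]
    flip-decreasing (d<b ∷ all@(_ ∷ _)) (_∷_ {y = e} d>e downs) =
      (∸-monoʳ-< (s≤s d>e) d<b , flip<b) ∷ flip-decreasing all downs
      where flip<b = ∸-monoʳ-< {o = 0} z<s (<-trans d>e d<b)

    gaps< : ∀ {x xs} → Increasing (x ∷ xs) → All (_< b) (gapsFrom x xs)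
    gaps< [-]                   = []
    gaps< ((x<y , y<2^b) ∷ inc) = gap< b x<y y<2^b ∷ gaps< inc

    up-increasing : ∀ {G} → All (_< b) G → Linked _<_ G → Linked _<[ b ]_ G
    up-increasing _                      []          = []
    up-increasing _                      [-]         = [-]
    up-increasing (_ ∷ all@(e<b ∷ _)) (d<e ∷ ups) = (d<e , e<b) ∷ up-increasing all ups

    -- The mixture of rules for four or more faces.

    module MoreFaces {j D} (B : Beats (2 + j) b D) where

      -- When the gaps are not monotone, the rule monotone may score 0 instead of D + 1; the
      -- factor suc D lets the gain of the windows make up for this.
      upRule downRule monotone combined : Rule
      upRule y zero    = 0
      upRule y (suc r) = rule B (gaps y) r
      downRule y       = guard (3 + j) (rule B (map flip (gaps y)))
      monotone y       = if rises y then upRule y else downRule y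
      combined y r     = suc D * windows (suc j) y r + monotone y r

      length-gaps : ∀ y {n} → length y ≡ suc n → length (gaps y) ≡ n
      length-gaps (x ∷ y) eq = trans (length-gapsFrom x y) (suc-injective eq)

      tot-monotone : ∀ y → length y ≡ 3 + j → tot (monotone y) (4 + j) ≡ D
      tot-monotone y eq with rises y
      ... | true  = total B (gaps y) (length-gaps y eq)
      ... | false = trans (tot-guard (3 + j) (rule B (map flip (gaps y))) (n≤1+n (3 + j)))
        (total B _ (trans (length-map flip (gaps y)) (length-gaps y eq)))

      score-monotone-up : ∀ x S → length S ≡ 3 + j → Increasing (x ∷ S) → Linked _<_ (gapsFrom x S) →
                          suc D ≤ score monotone (x ∷ S)
      score-monotone-up x S@(_ ∷ _ ∷ _ ∷ _) eq inc ups@(d<e ∷ e<f ∷ _) = begin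
        suc D
          ≤⟨ gain B _ (trans (length-gapsFrom x S) eq) (up-increasing (gaps< inc) ups) ⟩
        score (rule B) (gapsFrom x S)                ≡⟨ score-up (rule B) x S inc ups ⟨
        -- `upRule` never guesses rank 0, so hiding `x` adds 0; every other number has a rank one
        -- above that of the gap to its left.
        score (λ ys → rule B (gapsFrom x ys)) S      ≡⟨⟩
        score upRule (x ∷ S)                         ≤⟨ score-mono (x ∷ S) selected ⟩
        score monotone (x ∷ S)                       ∎
        where
        open ≤-Reasoning
        selected : ∀ {y} → Removal (x ∷ S) y → ∀ r → upRule y r ≤ monotone y r
        selected rem r rewrite rises-up inc d<e e<f rem = ≤-refl

      score-monotone-down : ∀ x S → length S ≡ 3 + j → Increasing (x ∷ S) → Linked _>_ (gapsFrom x S) →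
                            suc D ≤ score monotone (x ∷ S)
      score-monotone-down x S@(_ ∷ _ ∷ _ ∷ _) eq inc downs@(e<d ∷ f<e ∷ _) = begin
        suc D
          ≤⟨ gain B _ (trans (length-map flip (gapsFrom x S)) lengthG) (flip-decreasing (gaps< inc) downs) ⟩
        score (rule B) (map flip (gapsFrom x S))     ≡⟨ score-map flip (rule B) (gapsFrom x S) ⟨
        -- There are `3 + j` gaps, so `guard` cuts off no rank of a vanished gap; it only forbids
        -- guessing that the highest number is hidden.
        score (rule B ∘ map flip) (gapsFrom x S)
          ≡⟨ score-guard (3 + j) (rule B ∘ map flip) (gapsFrom x S) (≤-reflexive lengthG) ⟨
        score (guard (3 + j) ∘ rule B ∘ map flip) (gapsFrom x S)
          ≤⟨ score-down (guard (3 + j) ∘ rule B ∘ map flip) x S inc downs ⟩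
        score downRule (x ∷ S)                       ≤⟨ score-mono (x ∷ S) selected ⟩
        score monotone (x ∷ S)                       ∎
        where
        open ≤-Reasoning
        lengthG = trans (length-gapsFrom x S) eq
        selected : ∀ {y} → Removal (x ∷ S) y → ∀ r → downRule y r ≤ monotone y r
        selected rem r rewrite rises-down inc e<d f<e rem = ≤-refl

      score-combined : ∀ S → score combined S ≡ suc D * score (windows (suc j)) S + score monotone S
      score-combined S = trans (score-+ (λ y r → suc D * windows (suc j) y r) monotone S)
        (cong (_+ score monotone S) (score-* (suc D) (windows (suc j)) S))

      beats : Beats (3 + j) (2 ^ b) (suc D * (5 * suc j) + D)
      rule  beats = combined
      total beats y eq = begin
        tot (combined y) (4 + j)
          ≡⟨ tot-+ (λ r → suc D * windows (suc j) y r) (monotone y) (4 + j) ⟩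
        tot (λ r → suc D * windows (suc j) y r) (4 + j) + tot (monotone y) (4 + j)
          ≡⟨ cong₂ _+_ (tot-* (suc D) (windows (suc j) y) (4 + j)) (tot-monotone y eq) ⟩
        suc D * tot (windows (suc j) y) (4 + j) + D
          ≡⟨ cong (λ t → suc D * t + D) (tot-windows (suc j) y eq) ⟩
        suc D * (5 * suc j) + D ∎
        where open ≡-Reasoning
      gain  beats S@(x ∷ S′) eq inc = begin
        suc (suc D * (5 * suc j) + D)                            ≡⟨ +-suc (suc D * (5 * suc j)) D ⟨
        suc D * (5 * suc j) + suc D                              ≤⟨ bound (shape (suc j) S eq inc) ⟩
        suc D * score (windows (suc j)) S + score monotone S     ≡⟨ score-combined S ⟨
        score combined S                                         ∎
        where
        open ≤-Reasoning
        bound : Shape (suc j) S →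
                suc D * (5 * suc j) + suc D ≤ suc D * score (windows (suc j)) S + score monotone S
        bound (allUp ups p)     = +-mono-≤ (*-monoʳ-≤ (suc D) p)
          (score-monotone-up x S′ (suc-injective eq) inc ups)
        bound (allDown downs p) = +-mono-≤ (*-monoʳ-≤ (suc D) p)
          (score-monotone-down x S′ (suc-injective eq) inc downs)
        bound (mixed p)         = begin
          suc D * (5 * suc j) + suc D          ≡⟨ +-comm _ (suc D) ⟩
          suc D + suc D * (5 * suc j)          ≡⟨ *-suc (suc D) (5 * suc j) ⟨
          suc D * suc (5 * suc j)              ≤⟨ *-monoʳ-≤ (suc D) p ⟩
          suc D * score (windows (suc j)) S    ≤⟨ m≤m+n _ _ ⟩
          suc D * score (windows (suc j)) S + score monotone S ∎

  -- Iterating the stepping-up.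

  tower : ℕ → ℕ → ℕ
  tower zero    M = M
  tower (suc j) M = 2 ^ tower j M

  denominator : ℕ → ℕ → ℕ
  denominator zero          M = M
  denominator (suc zero)    M = 2 * M
  denominator (suc (suc j)) M = suc (denominator (suc j) M) * (5 * suc j) + denominator (suc j) M

  tower-beats : ∀ j M → Beats (suc j) (tower j M) (denominator j M)
  tower-beats zero          M = Threshold.beats M
  tower-beats (suc zero)    M = SteppingUp.ThreeFaces.beats M
  tower-beats (suc (suc j)) M = SteppingUp.MoreFaces.beats (tower (suc j) M) (tower-beats (suc j) M)

  -- This is `denominator j 1`. As `denominator j M` is affine in `M` with nonnegative coefficients,
  -- it is at most `M` times this value when `M` is positive.
  slope : ℕ → ℕ
  slope zero          = 1
  slope (suc zero)    = 2
  slope (suc (suc j)) = suc (slope (suc j)) * (5 * suc j) + slope (suc j)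

  slope-step : ∀ {d s M} k → 1 ≤ M → d ≤ s * M → suc d * k + d ≤ (suc s * k + s) * M
  slope-step {d} {s} {M} k 1≤M d≤sM = begin
    suc d * k + d                  ≤⟨ +-mono-≤ (*-monoˡ-≤ k (+-mono-≤ 1≤M d≤sM)) d≤sM ⟩
    (M + s * M) * k + s * M
      ≡⟨ solve 3 (λ m s k → (m :+ s :* m) :* k :+ s :* m := ((con 1 :+ s) :* k :+ s) :* m) refl M s k ⟩
    (suc s * k + s) * M            ∎
    where
    open ≤-Reasoning
    open +-*-Solver

  denominator≤ : ∀ j {M} → 1 ≤ M → denominator j M ≤ slope j * M
  denominator≤ zero          {M} 1≤M = ≤-reflexive (sym (*-identityˡ M))
  denominator≤ (suc zero)        1≤M = ≤-refl
  denominator≤ (suc (suc j))     1≤M = slope-step (5 * suc j) 1≤M (denominator≤ (suc j) 1≤M)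

  M≤denominator : ∀ j M → M ≤ denominator j M
  M≤denominator zero          M = ≤-refl
  M≤denominator (suc zero)    M = m≤n*m M 2
  M≤denominator (suc (suc j)) M = ≤-trans (M≤denominator (suc j) M) (m≤n+m _ _)

-- Subsets, sorting and permutations.

module Sets where
  open import Data.Nat.Base
  open import Data.Nat.Properties
  open import Relation.Binary.PropositionalEquality
  open import Algebra.Properties.CommutativeSemigroup *-commutativeSemigroup using (interchange)
  open SortingAlgorithm sortingAlgorithm
  open Rules
  open Beats

  AllPairs-resp-⊆ : ∀ {a ℓ} {A : Set a} {R : Rel A ℓ} {xs ys : List A} → xs ⊆ ys → AllPairs R ys → AllPairs R xs
  AllPairs-resp-⊆ []            []         = []
  AllPairs-resp-⊆ (y ∷ʳ xs⊆ys)  (_ ∷ rel)  = AllPairs-resp-⊆ xs⊆ys rel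
  AllPairs-resp-⊆ (refl ∷ xs⊆ys) (px ∷ rel) = All-resp-⊆ xs⊆ys px ∷ AllPairs-resp-⊆ xs⊆ys rel

  choose-⊆ : ∀ {a} {A : Set a} n (xs : List A) {S : Vec A n} → S ∈ choose n xs → toList S ⊆ xs
  choose-⊆ zero    xs       (here refl) = minimum xs
  choose-⊆ (suc n) (x ∷ xs) S∈ with ∈-++⁻ (map (x ∷_) (choose n xs)) S∈
  ... | inj₂ S∈′ = x ∷ʳ choose-⊆ (suc n) xs S∈′
  ... | inj₁ S∈′ with ∈-map⁻ (x ∷_) S∈′
  ...   | _ , S′∈ , refl = refl ∷ choose-⊆ n xs S′∈

  values : ∀ {N n} → Vec (Fin N) n → Fin n → ℕ
  values S = toℕ ∘ lookup S

  subset-increasing : ∀ n {N} {S : Vec (Fin N) n} → S ∈ subsets n N → AllPairs _<[ N ]_ (tabulate (values S))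
  subset-increasing n {N} {S} S∈ = subst (AllPairs _<[ N ]_) (map-toList S)
    (AllPairs.map⁺ (AllPairs.map (λ {i} {j} i<j → i<j , toℕ<n j)
      (AllPairs-resp-⊆ (choose-⊆ n (allFin N) S∈) (AllPairs.tabulate⁺-< id))))
    where
    map-toList : ∀ {n} (S : Vec (Fin N) n) → map toℕ (toList S) ≡ tabulate (values S)
    map-toList []      = refl
    map-toList (x ∷ S) = cong (toℕ x ∷_) (map-toList S)

  remove-⊆ : ∀ {a} {A : Set a} {n} (s : Fin (suc n) → A) i → tabulate (s ∘ punchIn i) ⊆ tabulate s
  remove-⊆ s zero            = s zero ∷ʳ ⊆-refl
  remove-⊆ {n = suc n} s (suc i) = refl ∷ remove-⊆ (s ∘ suc) i

  tabulate-extract : ∀ {a} {A : Set a} {n} (s : Fin (suc n) → A) i → tabulate s ↭ s i ∷ tabulate (s ∘ punchIn i)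
  tabulate-extract s zero = ↭-refl
  tabulate-extract {n = suc n} s (suc i) =
    ↭-trans (↭-prep (s zero) (tabulate-extract (s ∘ suc) i)) (↭-swap (s zero) (s (suc i)) ↭-refl)

  -- Induction: after splitting off the value at face 0, the other values are permuted by
  -- `Perm.remove zero π`.
  tabulate-permute : ∀ {a} {A : Set a} {n} (s : Fin n → A) (π : Permutation′ n) →
                     tabulate (s ∘ (π ⟨$⟩ʳ_)) ↭ tabulate s
  tabulate-permute {n = zero}  s π = ↭-refl
  tabulate-permute {n = suc n} s π = ↭-trans
    (↭-prep (s (π ⟨$⟩ʳ zero)) (↭-trans
      (↭-reflexive (tabulate-cong (λ j → cong s (Perm.punchIn-permute π zero j))))
      (tabulate-permute (s ∘ punchIn (π ⟨$⟩ʳ zero)) (Perm.remove zero π))))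
    (↭-sym (tabulate-extract s (π ⟨$⟩ʳ zero)))

  inject₁-punchIn : ∀ n (i : Fin n) → inject₁ i ≡ punchIn (fromℕ n) i
  inject₁-punchIn (suc n) zero    = refl
  inject₁-punchIn (suc n) (suc i) = cong suc (inject₁-punchIn n i)

  sorted : ∀ {N n} → Vec (Fin N) n → List ℕ
  sorted v = sort (tabulate (values v))

  length-sorted : ∀ {N n} (v : Vec (Fin N) n) → length (sorted v) ≡ n
  length-sorted v = trans (↭-length (sort-↭ (tabulate (values v)))) (length-tabulate (values v))

  sorted-↭ : ∀ {N n} (v : Vec (Fin N) n) {ys : List ℕ} →
             AllPairs _≤_ ys → tabulate (values v) ↭ ys → sorted v ≡ ys
  sorted-↭ v {ys} ys↗ v↭ys = Pointwise-≡⇒≡ (↗↭↗⇒≋ ≤-totalOrder (sort-↗ _) (Linked.AllPairs⇒Linked ys↗)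
    (↭⇒↭ₛ (↭-trans (sort-↭ (tabulate (values v))) v↭ys)))

  module _ {a ℓ₁ ℓ₂} (K : ArchimedeanOrderedField a ℓ₁ ℓ₂) where

    -- The visible faces show the numbers of all ranks but the hidden one, in the order given by
    -- `Perm.remove (fromℕ m) π`. Sorting undoes that permutation because `S` is increasing.
    sorted-visible : ∀ {m N} (S : Vec (Fin N) (suc m)) → S ∈ subsets (suc m) N → ∀ π →
                     sorted (visible K S π) ≡ tabulate (values S ∘ punchIn (hiddenRank K π))
    sorted-visible {m} S S∈ π = sorted-↭ (visible K S π)
      (AllPairs-resp-⊆ (remove-⊆ (values S) (hiddenRank K π))
        (AllPairs.map (<⇒≤ ∘ proj₁) (subset-increasing (suc m) S∈)))
      (↭-trans (↭-reflexive (tabulate-cong visible-values))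
        (tabulate-permute (values S ∘ punchIn (hiddenRank K π)) (Perm.remove (fromℕ m) π)))
      where
      visible-values : ∀ j → values (visible K S π) j ≡
                             values S (punchIn (hiddenRank K π) (Perm.remove (fromℕ m) π ⟨$⟩ʳ j))
      visible-values j = trans (cong toℕ (lookup∘tabulate _ j))
        (cong (values S) (trans (cong (π ⟨$⟩ʳ_) (inject₁-punchIn m j)) (Perm.punchIn-permute π (fromℕ m) j)))

  -- Reads off the hidden rank of a permutation built by `permutations`, where the image of the last
  -- face is inserted.
  insert-self : ∀ {n} i j (π : Permutation′ n) → Perm.insert i j π ⟨$⟩ʳ i ≡ j
  insert-self i j π with i ≟ᶠ i
  ... | yes _   = refl
  ... | no  i≢i = contradiction refl i≢i

  length-concatMap : ∀ {a b} {A : Set a} {B : Set b} (f : A → List B) {k} → (∀ x → length (f x) ≡ k) →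
                     ∀ xs → length (concatMap f xs) ≡ length xs * k
  length-concatMap f eq []       = refl
  length-concatMap f eq (x ∷ xs) = trans (length-++ (f x)) (cong₂ _+_ (eq x) (length-concatMap f eq xs))

  length-permutations : ∀ n → length (permutations n) ≡ n !
  length-permutations zero    = refl
  length-permutations (suc n) = trans
    (length-concatMap (λ i → map (Perm.insert (fromℕ n) i) (permutations n))
      (λ i → trans (length-map (Perm.insert (fromℕ n) i) (permutations n)) (length-permutations n))
      (allFin (suc n)))
    (cong (_* n !) (length-tabulate {n = suc n} id))

  module _ {k N′ D} (B : Beats k N′ D) where

    total-truncate : ∀ y m → length y ≡ m → k ≤ m → tot (truncate k (rule B) y) (suc m) ≡ D
    total-truncate y m refl k≤m = trans (tot-guard (suc k) (rule B (take k y)) (s≤s k≤m))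
      (total B (take k y) (trans (length-take k y) (m≤n⇒m⊓n≡m k≤m)))

    gain-truncate : ∀ {m N} → k ≤ m → N ≤ N′ → (S : Vec (Fin N) (suc m)) → S ∈ subsets (suc m) N →
                    suc D ≤ score (truncate k (rule B)) (tabulate (values S))
    gain-truncate {m} {N} k≤m N≤N′ S S∈ = ≤-trans
      (gain B _ (trans (length-take (suc k) (tabulate (values S)))
          (trans (cong (suc k ⊓_) (length-tabulate (values S))) (m≤n⇒m⊓n≡m (s≤s k≤m))))
        (Linked.AllPairs⇒Linked (AllPairs.take⁺ (suc k)
          (AllPairs.map (λ (x<y , y<N) → x<y , <-≤-trans y<N N≤N′) (subset-increasing (suc m) S∈)))))
      (≤-reflexive (sym (score-truncate k (rule B) (tabulate (values S)))))

  -- Towers and their comparison with positive reals.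

  m<2^m : ∀ m → m < 2 ^ m
  m<2^m zero    = z<s
  m<2^m (suc m) = begin-strict
    suc m             ≤⟨ m<2^m m ⟩
    2 ^ m             <⟨ m<m+n (2 ^ m) (≤-trans (m^n>0 2 m) (m≤m+n (2 ^ m) 0)) ⟩
    2 ^ suc m         ∎
    where open ≤-Reasoning

  M≤tower : ∀ j M → M ≤ tower j M
  M≤tower zero    M = ≤-refl
  M≤tower (suc j) M = ≤-trans (M≤tower j M) (<⇒≤ (m<2^m (tower j M)))

  -- A discrete inverse of the tower, found by searching downwards: the rule with top `suc L` covers
  -- all numbers below `N`, while the top `L` serves for the lower bound on `N`.
  tower-bracket : ∀ j N M → N ≤ tower j (suc M) → Σ[ L ∈ ℕ ] N ≤ tower j (suc L) × (L ≡ 0 ⊎ tower j L ≤ N)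
  tower-bracket j N zero    N≤ = 0 , N≤ , inj₁ refl
  tower-bracket j N (suc M) N≤ with N ≤? tower j (suc M)
  ... | yes N≤′ = tower-bracket j N M N≤′
  ... | no  N≰  = suc M , N≤ , inj₂ (≰⇒≥ N≰)

  ^-distribʳ-* : ∀ o m n → (m * n) ^ o ≡ m ^ o * n ^ o
  ^-distribʳ-* zero    m n = refl
  ^-distribʳ-* (suc o) m n = trans (cong (m * n *_) (^-distribʳ-* o m n)) (interchange m n (m ^ o) (n ^ o))

  -- Roots are avoided by comparing powers with exponent `suc b`: if `p` exceeded `2 ^ M * suc q`,
  -- its power would be too large for the bound that witnesses `(2^ T) p q`.
  2^-≤ℕ : ∀ {ℓ} {T : PosReal ℓ} {M} → T ≤ℕ M → (2^ T) ≤ℕ 2 ^ M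
  2^-≤ℕ {M = M} T≤M p q (a , b , Tab , p^<) = ≮⇒≥ λ M<p → <⇒≱ p^< (begin
    2 ^ a * suc q ^ suc b             ≤⟨ *-monoˡ-≤ (suc q ^ suc b) (^-monoʳ-≤ 2 (T≤M a b Tab)) ⟩
    2 ^ (M * suc b) * suc q ^ suc b   ≡⟨ cong (_* suc q ^ suc b) (^-*-assoc 2 M (suc b)) ⟨
    (2 ^ M) ^ suc b * suc q ^ suc b   ≡⟨ ^-distribʳ-* (suc b) (2 ^ M) (suc q) ⟨
    (2 ^ M * suc q) ^ suc b           ≤⟨ ^-monoˡ-≤ (suc b) (<⇒≤ M<p) ⟩
    p ^ suc b                         ∎)
    where open ≤-Reasoning

  twos-≤ℕ : ∀ {ℓ} j {T : PosReal ℓ} {M} → T ≤ℕ M → twos j T ≤ℕ tower j M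
  twos-≤ℕ zero    T≤M = T≤M
  twos-≤ℕ (suc j) {T} {M} T≤M = 2^-≤ℕ {T = twos j T} {tower j M} (twos-≤ℕ j {T} {M} T≤M)

  -- The spare factor 2 pays for the passage from `suc L` to `L`, as `suc L` is at most `L + L`.
  halve : ∀ p q {L} → 1 ≤ L → 2 * p ≤ suc q * suc L → p ≤ L * suc q
  halve p q {L} 1≤L 2p≤ = *-cancelˡ-≤ 2 (begin
    2 * p                 ≤⟨ 2p≤ ⟩
    suc q * suc L         ≤⟨ *-monoʳ-≤ (suc q) (+-monoˡ-≤ L 1≤L) ⟩
    suc q * (L + L)       ≡⟨ solve 2 (λ q l → q :* (l :+ l) := con 2 :* (l :* q)) refl (suc q) L ⟩
    2 * (L * suc q)       ∎)
    where
    open ≤-Reasoning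
    open +-*-Solver

open Rules
open Beats using (rule)
open Sets

-- Arithmetic in an ordered field.

module _ {a ℓ₁ ℓ₂} (K : ArchimedeanOrderedField a ℓ₁ ℓ₂) where
  open ArchimedeanOrderedField K hiding (zero)
  open IsDecTotalOrder isDecTotalOrder using (isPartialOrder; antisym; ≤-respˡ-≈; ≤-respʳ-≈)
    renaming (total to ≤-total; refl to ≤-refl; trans to ≤-trans; reflexive to ≤-reflexive)
  open import Algebra.Properties.Ring ring using (-‿distribˡ-*; -‿involutive)
  open import Algebra.Properties.Semiring.Mult semiring using (×-homo-+; ×1-homo-*)
  open import Algebra.Properties.CommutativeSemigroup *-commutativeSemigroup
    using (x∙yz≈y∙xz; xy∙z≈xz∙y; interchange)

  poset : Poset a ℓ₁ ℓ₂
  poset = record { isPartialOrder = isPartialOrder }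

  open import Relation.Binary.Reasoning.PartialOrder poset

  +-mono : ∀ {x y u v} → x ≤ y → u ≤ v → x + u ≤ y + v
  +-mono {x} {y} {u} {v} x≤y u≤v = begin
    x + u ≤⟨ +-monoʳ-≤ x u≤v ⟩
    x + v ≈⟨ +-comm x v ⟩
    v + x ≤⟨ +-monoʳ-≤ v x≤y ⟩
    v + y ≈⟨ +-comm v y ⟩
    y + v ∎

  +-nonNegative : ∀ {x y} → 0# ≤ x → 0# ≤ y → 0# ≤ x + y
  +-nonNegative 0≤x 0≤y = ≤-respˡ-≈ (+-identityˡ 0#) (+-mono 0≤x 0≤y)

  +-cancelˡ : ∀ z {x y} → z + x ≤ z + y → x ≤ y
  +-cancelˡ z {x} {y} z+x≤z+y = begin
    x               ≈⟨ cancel x ⟨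
    - z + (z + x)   ≤⟨ +-monoʳ-≤ (- z) z+x≤z+y ⟩
    - z + (z + y)   ≈⟨ cancel y ⟩
    y               ∎
    where
    cancel : ∀ t → - z + (z + t) ≈ t
    cancel t = trans (sym (+-assoc (- z) z t)) (trans (+-congʳ (-‿inverseˡ z)) (+-identityˡ t))

  *-monoˡ : ∀ {z x y} → 0# ≤ z → x ≤ y → z * x ≤ z * y
  *-monoˡ {z} {x} {y} 0≤z x≤y = begin
    z * x                   ≈⟨ +-identityʳ (z * x) ⟨
    z * x + 0#              ≤⟨ +-monoʳ-≤ (z * x) (*-nonNegative 0≤z 0≤y-x) ⟩
    z * x + z * (- x + y)   ≈⟨ distribˡ z x (- x + y) ⟨
    z * (x + (- x + y))
      ≈⟨ *-congˡ (trans (sym (+-assoc x (- x) y)) (trans (+-congʳ (-‿inverseʳ x)) (+-identityˡ y))) ⟩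
    z * y                   ∎
    where
    0≤y-x : 0# ≤ - x + y
    0≤y-x = ≤-respˡ-≈ (-‿inverseˡ x) (+-monoʳ-≤ (- x) x≤y)

  *-monoʳ : ∀ {z x y} → 0# ≤ z → x ≤ y → x * z ≤ y * z
  *-monoʳ {z} {x} {y} 0≤z x≤y = begin
    x * z ≈⟨ *-comm x z ⟩
    z * x ≤⟨ *-monoˡ 0≤z x≤y ⟩
    z * y ≈⟨ *-comm z y ⟩
    y * z ∎

  square-nonNegative : ∀ x → 0# ≤ x * x
  square-nonNegative x with ≤-total 0# x
  ... | inj₁ 0≤x = *-nonNegative 0≤x 0≤x
  ... | inj₂ x≤0 = ≤-respʳ-≈ -x*-x≈x*x (*-nonNegative 0≤-x 0≤-x)
    where
    0≤-x : 0# ≤ - x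
    0≤-x = begin
      0#         ≈⟨ -‿inverseˡ x ⟨
      - x + x    ≤⟨ +-monoʳ-≤ (- x) x≤0 ⟩
      - x + 0#   ≈⟨ +-identityʳ (- x) ⟩
      - x        ∎
    -x*-x≈x*x : - x * - x ≈ x * x
    -x*-x≈x*x = trans (sym (-‿distribˡ-* x (- x)))
      (trans (-‿cong (trans (*-comm x (- x)) (sym (-‿distribˡ-* x x)))) (-‿involutive (x * x)))

  0≤1 : 0# ≤ 1#
  0≤1 = ≤-respʳ-≈ (*-identityˡ 1#) (square-nonNegative 1#)

  fromNat-nonNegative : ∀ n → 0# ≤ fromNat n
  fromNat-nonNegative zero    = ≤-refl
  fromNat-nonNegative (suc n) = +-nonNegative 0≤1 (fromNat-nonNegative n)

  fromNat-+ : ∀ m n → fromNat (m ℕ.+ n) ≈ fromNat m + fromNat n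
  fromNat-+ = ×-homo-+ 1#

  fromNat-* : ∀ m n → fromNat (m ℕ.* n) ≈ fromNat m * fromNat n
  fromNat-* = ×1-homo-*

  fromNat-mono : ∀ {m n} → m ℕ.≤ n → fromNat m ≤ fromNat n
  fromNat-mono {n = n} z≤n = fromNat-nonNegative n
  fromNat-mono (s≤s m≤n)   = +-monoʳ-≤ 1# (fromNat-mono m≤n)

  fromNat-cancel : ∀ m n → fromNat m ≤ fromNat n → m ℕ.≤ n
  fromNat-cancel zero    n       _   = z≤n
  fromNat-cancel (suc m) zero    m≤n = contradiction
    (antisym 0≤1 (≤-trans (≤-respˡ-≈ (+-identityʳ 1#) (+-monoʳ-≤ 1# (fromNat-nonNegative m))) m≤n)) 0≉1
  fromNat-cancel (suc m) (suc n) m≤n = s≤s (fromNat-cancel m n (+-cancelˡ 1# m≤n))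

  fromNat≉0 : ∀ {n} → 1 ℕ.≤ n → ¬ fromNat n ≈ 0#
  fromNat≉0 {n} 1≤n n≈0 = ℕ.<⇒≱ 1≤n (fromNat-cancel n 0 (≤-reflexive n≈0))

  ⁻¹-inverseˡ : ∀ {x} → ¬ x ≈ 0# → x ⁻¹ * x ≈ 1#
  ⁻¹-inverseˡ {x} x≉0 = trans (*-comm (x ⁻¹) x) (⁻¹-inverseʳ x≉0)

  ⁻¹-unique : ∀ {x y} → ¬ x ≈ 0# → x * y ≈ 1# → y ≈ x ⁻¹
  ⁻¹-unique {x} {y} x≉0 xy≈1 = begin-equality
    y               ≈⟨ *-identityˡ y ⟨
    1# * y          ≈⟨ *-congʳ (⁻¹-inverseˡ x≉0) ⟨
    x ⁻¹ * x * y    ≈⟨ *-assoc (x ⁻¹) x y ⟩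
    x ⁻¹ * (x * y)  ≈⟨ *-congˡ xy≈1 ⟩
    x ⁻¹ * 1#       ≈⟨ *-identityʳ (x ⁻¹) ⟩
    x ⁻¹            ∎

  -- The inverse is `x` times the square of `x ⁻¹`.
  ⁻¹-nonNegative : ∀ {x} → ¬ x ≈ 0# → 0# ≤ x → 0# ≤ x ⁻¹
  ⁻¹-nonNegative {x} x≉0 0≤x = begin
    0#                  ≤⟨ *-nonNegative 0≤x (square-nonNegative (x ⁻¹)) ⟩
    x * (x ⁻¹ * x ⁻¹)   ≈⟨ *-assoc x (x ⁻¹) (x ⁻¹) ⟨
    x * x ⁻¹ * x ⁻¹     ≈⟨ *-congʳ (⁻¹-inverseʳ x≉0) ⟩
    1# * x ⁻¹           ≈⟨ *-identityˡ (x ⁻¹) ⟩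
    x ⁻¹                ∎

  ⁻¹≉0 : ∀ {x} → ¬ x ≈ 0# → ¬ x ⁻¹ ≈ 0#
  ⁻¹≉0 {x} x≉0 x⁻¹≈0 = 0≉1 (begin-equality
    0#         ≈⟨ zeroʳ x ⟨
    x * 0#     ≈⟨ *-congˡ x⁻¹≈0 ⟨
    x * x ⁻¹   ≈⟨ ⁻¹-inverseʳ x≉0 ⟩
    1#         ∎)

  -- Finite sums, and scores as sums over the hidden rank.

  module _ {b} {A : Set b} where

    ∑-mono : ∀ (xs : List A) {f g} → (∀ {x} → x ∈ xs → f x ≤ g x) → ∑ K xs f ≤ ∑ K xs g
    ∑-mono []       f≤g = ≤-refl
    ∑-mono (x ∷ xs) f≤g = +-mono (f≤g (here ≡.refl)) (∑-mono xs (f≤g ∘ there))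

    ∑-*ʳ : ∀ (xs : List A) f c → ∑ K xs (λ x → f x * c) ≈ ∑ K xs f * c
    ∑-*ʳ []       f c = sym (zeroˡ c)
    ∑-*ʳ (x ∷ xs) f c = trans (+-congˡ (∑-*ʳ xs f c)) (sym (distribʳ c (f x) (∑ K xs f)))

    ∑-const : ∀ (xs : List A) {f c} → (∀ x → f x ≈ c) → ∑ K xs f ≈ fromNat (length xs) * c
    ∑-const []       {c = c} f≈c = sym (zeroˡ c)
    ∑-const (x ∷ xs) {f} {c} f≈c = begin-equality
      f x + ∑ K xs f                        ≈⟨ +-cong (f≈c x) (∑-const xs f≈c) ⟩
      c + fromNat (length xs) * c           ≈⟨ +-congʳ (*-identityˡ c) ⟨
      1# * c + fromNat (length xs) * c      ≈⟨ distribʳ c 1# (fromNat (length xs)) ⟨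
      fromNat (length (x ∷ xs)) * c         ∎

    ∑-++ : ∀ (xs ys : List A) f → ∑ K (xs ++ ys) f ≈ ∑ K xs f + ∑ K ys f
    ∑-++ []       ys f = sym (+-identityˡ (∑ K ys f))
    ∑-++ (x ∷ xs) ys f = trans (+-congˡ (∑-++ xs ys f)) (sym (+-assoc (f x) (∑ K xs f) (∑ K ys f)))

    ∑-concatMap : ∀ {c} {B : Set c} (g : B → List A) ys f → ∑ K (concatMap g ys) f ≈ ∑ K ys (λ y → ∑ K (g y) f)
    ∑-concatMap g []       f = refl
    ∑-concatMap g (y ∷ ys) f = trans (∑-++ (g y) (concatMap g ys) f) (+-congˡ (∑-concatMap g ys f))

    ∑-map : ∀ {c} {B : Set c} (g : B → A) ys f → ∑ K (map g ys) f ≈ ∑ K ys (f ∘ g)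
    ∑-map g []       f = refl
    ∑-map g (y ∷ ys) f = +-congˡ (∑-map g ys f)

    ∑-tot : ∀ {n} (g : Fin n → A) f u d → (∀ i → f (g i) ≈ fromNat (u (toℕ i)) * d) →
            ∑ K (tabulate g) f ≈ fromNat (tot u n) * d
    ∑-tot {zero}  g f u d f≈u = sym (zeroˡ d)
    ∑-tot {suc n} g f u d f≈u = begin-equality
      f (g zero) + ∑ K (tabulate (g ∘ suc)) f
        ≈⟨ +-cong (f≈u zero) (∑-tot (g ∘ suc) f (u ∘ suc) d (f≈u ∘ suc)) ⟩
      fromNat (u 0) * d + fromNat (tot (u ∘ suc) n) * d    ≈⟨ distribʳ d _ _ ⟨
      (fromNat (u 0) + fromNat (tot (u ∘ suc) n)) * d
        ≈⟨ *-congʳ (fromNat-+ (u 0) (tot (u ∘ suc) n)) ⟨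
      fromNat (tot u (suc n)) * d                          ∎

    ∑-score : ∀ {m} (g : Fin (suc m) → A) f w (s : Fin (suc m) → ℕ) d →
              (∀ i → f (g i) ≈ fromNat (w (tabulate (s ∘ punchIn i)) (toℕ i)) * d) →
              ∑ K (tabulate g) f ≈ fromNat (score w (tabulate s)) * d
    ∑-score {m} g f w s d f≈w = begin-equality
      f (g zero) + ∑ K (tabulate (g ∘ suc)) f
        ≈⟨ +-cong (f≈w zero) (rest m g s f≈w) ⟩
      fromNat (w (tabulate (s ∘ suc)) 0) * d + fromNat (score (peel (s zero) w) (tabulate (s ∘ suc))) * d
        ≈⟨ distribʳ d _ _ ⟨
      (fromNat (w (tabulate (s ∘ suc)) 0) + fromNat (score (peel (s zero) w) (tabulate (s ∘ suc)))) * d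
        ≈⟨ *-congʳ (fromNat-+ (w (tabulate (s ∘ suc)) 0) _) ⟨
      fromNat (score w (tabulate s)) * d ∎
      where
      -- The induction hypothesis needs a nonempty tail for `punchIn` to act on, hence the case
      -- distinction on `m`.
      rest : ∀ m (g : Fin (suc m) → A) (s : Fin (suc m) → ℕ) →
             (∀ i → f (g i) ≈ fromNat (w (tabulate (s ∘ punchIn i)) (toℕ i)) * d) →
             ∑ K (tabulate (g ∘ suc)) f ≈ fromNat (score (peel (s zero) w) (tabulate (s ∘ suc))) * d
      rest zero    g s f≈w = sym (zeroˡ d)
      rest (suc m) g s f≈w = ∑-score (g ∘ suc) f (peel (s zero) w) (s ∘ suc) d (f≈w ∘ suc)

  -- The algorithm given by a rule, and its reward.

  module Guess {k N′ D m N} (B : Beats k N′ D) (k≤m : k ℕ.≤ m) (N≤N′ : N ℕ.≤ N′) (1≤D : 1 ℕ.≤ D) where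

    d : Carrier
    d = fromNat D

    d≉0 : ¬ d ≈ 0#
    d≉0 = fromNat≉0 1≤D

    lowest : Rule
    lowest = truncate k (rule B)

    algorithm : Algorithm K m N
    algorithm v = record
      { weight      = λ r → fromNat (lowest (sorted v) (toℕ r)) * d ⁻¹
      ; nonNegative = λ {r} _ → *-nonNegative (fromNat-nonNegative (lowest (sorted v) (toℕ r)))
          (⁻¹-nonNegative d≉0 (fromNat-nonNegative D))
      ; total       = begin-equality
          ∑ K (allFin (suc m)) _
            ≈⟨ ∑-tot {n = suc m} id _ (lowest (sorted v)) (d ⁻¹) (λ _ → refl) ⟩
          fromNat (tot (lowest (sorted v)) (suc m)) * d ⁻¹
            ≡⟨ ≡.cong (λ t → fromNat t * d ⁻¹) (total-truncate B (sorted v) m (length-sorted v) k≤m) ⟩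
          d * d ⁻¹                                        ≈⟨ ⁻¹-inverseʳ d≉0 ⟩
          1#                                              ∎
      }

    !≉0 : ∀ n → ¬ fromNat (n !) ≈ 0#
    !≉0 n = fromNat≉0 (ℕ.1≤n! n)

    target : Carrier
    target = (1# + d ⁻¹) / fromNat (suc m)

    -- Grouped by hidden rank, the permutations fall into classes of size `m !`. Within a class the
    -- sorted visible numbers agree, and so does the probability of a correct guess; summing these
    -- over the ranks gives the score.
    ∑-permutations : ∀ S → S ∈ subsets (suc m) N →
      ∑ K (permutations (suc m)) (λ π → weight (algorithm (visible K S π)) (hiddenRank K π))
        ≈ fromNat (score lowest (tabulate (values S))) * (fromNat (m !) * d ⁻¹)
    ∑-permutations S S∈ = begin-equality
      ∑ K (permutations (suc m)) f
        ≈⟨ ∑-concatMap (λ i → map (Perm.insert (fromℕ m) i) (permutations m)) (allFin (suc m)) f ⟩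
      ∑ K (allFin (suc m)) (λ i → ∑ K (map (Perm.insert (fromℕ m) i) (permutations m)) f)
        ≈⟨ ∑-score id _ lowest (values S) (fromNat (m !) * d ⁻¹) perRank ⟩
      fromNat (score lowest (tabulate (values S))) * (fromNat (m !) * d ⁻¹) ∎
      where
      f : Permutation′ (suc m) → Carrier
      f π = weight (algorithm (visible K S π)) (hiddenRank K π)
      chance : Fin (suc m) → ℕ
      chance i = lowest (tabulate (values S ∘ punchIn i)) (toℕ i)
      perPermutation : ∀ i π → f (Perm.insert (fromℕ m) i π) ≈ fromNat (chance i) * d ⁻¹
      perPermutation i π = reflexive (≡.cong (λ t → fromNat t * d ⁻¹)
        (≡.trans (≡.cong (λ y → lowest y (toℕ (hiddenRank K π′))) (sorted-visible K S S∈ π′))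
                 (≡.cong chance (insert-self (fromℕ m) i π))))
        where π′ = Perm.insert (fromℕ m) i π
      perRank : ∀ i → ∑ K (map (Perm.insert (fromℕ m) i) (permutations m)) f ≈
                fromNat (chance i) * (fromNat (m !) * d ⁻¹)
      perRank i = begin-equality
        ∑ K (map (Perm.insert (fromℕ m) i) (permutations m)) f
          ≈⟨ ∑-map (Perm.insert (fromℕ m) i) (permutations m) f ⟩
        ∑ K (permutations m) (f ∘ Perm.insert (fromℕ m) i)
          ≈⟨ ∑-const (permutations m) (perPermutation i) ⟩
        fromNat (length (permutations m)) * (fromNat (chance i) * d ⁻¹)
          ≡⟨ ≡.cong (λ t → fromNat t * (fromNat (chance i) * d ⁻¹)) (length-permutations m) ⟩
        fromNat (m !) * (fromNat (chance i) * d ⁻¹)              ≈⟨ x∙yz≈y∙xz _ _ _ ⟩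
        fromNat (chance i) * (fromNat (m !) * d ⁻¹)              ∎

    m!/n! : fromNat (m !) * fromNat (suc m !) ⁻¹ ≈ fromNat (suc m) ⁻¹
    m!/n! = ⁻¹-unique (fromNat≉0 {suc m} (s≤s z≤n)) (begin-equality
      fromNat (suc m) * (fromNat (m !) * fromNat (suc m !) ⁻¹) ≈⟨ *-assoc _ _ _ ⟨
      fromNat (suc m) * fromNat (m !) * fromNat (suc m !) ⁻¹   ≈⟨ *-congʳ (fromNat-* (suc m) (m !)) ⟨
      fromNat (suc m !) * fromNat (suc m !) ⁻¹                 ≈⟨ ⁻¹-inverseʳ (!≉0 (suc m)) ⟩
      1#                                                       ∎)

    target-≤-reward : ∀ S → S ∈ subsets (suc m) N → target ≤ rewardOn K algorithm S
    target-≤-reward S S∈ = begin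
      (1# + d ⁻¹) / fromNat (suc m)
        ≈⟨ *-congʳ (trans (+-comm 1# (d ⁻¹)) (+-cong (sym (*-identityˡ (d ⁻¹))) (sym (⁻¹-inverseʳ d≉0)))) ⟩
      (1# * d ⁻¹ + d * d ⁻¹) / fromNat (suc m)
        ≈⟨ *-congʳ (distribʳ (d ⁻¹) 1# d) ⟨
      fromNat (suc D) * d ⁻¹ * fromNat (suc m) ⁻¹
        ≈⟨ *-congˡ m!/n! ⟨
      fromNat (suc D) * d ⁻¹ * (fromNat (m !) * fromNat (suc m !) ⁻¹)
        ≈⟨ *-assoc _ _ _ ⟨
      fromNat (suc D) * d ⁻¹ * fromNat (m !) * fromNat (suc m !) ⁻¹
        ≈⟨ *-congʳ (trans (*-assoc _ _ _) (*-congˡ (*-comm _ _))) ⟩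
      fromNat (suc D) * (fromNat (m !) * d ⁻¹) * fromNat (suc m !) ⁻¹
        ≤⟨ *-monoʳ (⁻¹-nonNegative (!≉0 (suc m)) (fromNat-nonNegative (suc m !)))
             (*-monoʳ (*-nonNegative (fromNat-nonNegative (m !)) (⁻¹-nonNegative d≉0 (fromNat-nonNegative D)))
               (fromNat-mono (gain-truncate B k≤m N≤N′ S S∈))) ⟩
      fromNat (score lowest (tabulate (values S))) * (fromNat (m !) * d ⁻¹) * fromNat (suc m !) ⁻¹
        ≈⟨ *-congʳ (∑-permutations S S∈) ⟨
      rewardOn K algorithm S ∎

    target-≤-expected : ∀ F → target ≤ expectedReward K F algorithm
    target-≤-expected F = begin
      target                                                      ≈⟨ *-identityˡ target ⟨
      1# * target                                                 ≈⟨ *-congʳ (Distribution.total F) ⟨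
      ∑ K (subsets (suc m) N) (weight F) * target
        ≈⟨ ∑-*ʳ (subsets (suc m) N) (weight F) target ⟨
      ∑ K (subsets (suc m) N) (λ S → weight F S * target)
        ≤⟨ ∑-mono (subsets (suc m) N) (λ {S} S∈ → *-monoˡ (nonNegative F S∈) (target-≤-reward S S∈)) ⟩
      expectedReward K F algorithm                                ∎

    feasible-bound : ∀ {ε} → Feasible K m ε N → 1# ≤ d * ε
    feasible-bound {ε} (F , cap) = begin
      1#         ≈⟨ ⁻¹-inverseʳ d≉0 ⟨
      d * d ⁻¹   ≤⟨ *-monoˡ (fromNat-nonNegative D) (+-cancelˡ 1# 1+d⁻¹≤1+ε) ⟩
      d * ε      ∎
      where
      n : Carrier
      n = fromNat (suc m)
      cancel : ∀ x → x / n * n ≈ x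
      cancel x = trans (*-assoc x (n ⁻¹) n) (trans (*-congˡ (⁻¹-inverseˡ (fromNat≉0 {suc m} (s≤s z≤n)))) (*-identityʳ x))
      1+d⁻¹≤1+ε : 1# + d ⁻¹ ≤ 1# + ε
      1+d⁻¹≤1+ε = begin
        1# + d ⁻¹                     ≈⟨ cancel (1# + d ⁻¹) ⟨
        (1# + d ⁻¹) / n * n
          ≤⟨ *-monoʳ (fromNat-nonNegative (suc m)) (≤-trans (target-≤-expected F) (cap algorithm)) ⟩
        (1# + ε) / n * n              ≈⟨ cancel (1# + ε) ⟩
        1# + ε                        ∎

  -- From the advantage of the rule to the tower bound.

  module _ (C M : ℕ) {ε : Carrier} (1≤CMε : 1# ≤ fromNat (C ℕ.* M) * ε) where

    private
      s : Carrier
      s = fromNat (2 ℕ.* C)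

    -- Multiplying `2 * p` by the right side of `1≤CMε` brings in `ε`, which the hypothesis on `p`
    -- and `q` then removes. This one estimate yields both `2≤M` and `κ/ε-bound`.
    doubled-bound : ∀ p q → fromNat p * (s * ε) ≤ fromNat q → 2 ℕ.* p ℕ.≤ q ℕ.* M
    doubled-bound p q psε≤q = fromNat-cancel (2 ℕ.* p) (q ℕ.* M) (begin
      fromNat (2 ℕ.* p)                                ≈⟨ *-identityʳ _ ⟨
      fromNat (2 ℕ.* p) * 1#                           ≤⟨ *-monoˡ (fromNat-nonNegative (2 ℕ.* p)) 1≤CMε ⟩
      fromNat (2 ℕ.* p) * (fromNat (C ℕ.* M) * ε)      ≈⟨ *-assoc _ _ _ ⟨
      fromNat (2 ℕ.* p) * fromNat (C ℕ.* M) * ε        ≈⟨ *-congʳ (fromNat-* (2 ℕ.* p) (C ℕ.* M)) ⟨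
      fromNat (2 ℕ.* p ℕ.* (C ℕ.* M)) * ε              ≡⟨ ≡.cong (λ t → fromNat t * ε) regroup ⟩
      fromNat (p ℕ.* (2 ℕ.* C) ℕ.* M) * ε              ≈⟨ *-congʳ (fromNat-* (p ℕ.* (2 ℕ.* C)) M) ⟩
      fromNat (p ℕ.* (2 ℕ.* C)) * fromNat M * ε        ≈⟨ xy∙z≈xz∙y _ _ _ ⟩
      fromNat (p ℕ.* (2 ℕ.* C)) * ε * fromNat M
        ≈⟨ *-congʳ (trans (*-congʳ (fromNat-* p (2 ℕ.* C))) (*-assoc _ _ _)) ⟩
      fromNat p * (s * ε) * fromNat M                  ≤⟨ *-monoʳ (fromNat-nonNegative M) psε≤q ⟩
      fromNat q * fromNat M                            ≈⟨ fromNat-* q M ⟨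
      fromNat (q ℕ.* M)                                ∎)
      where
      open +-*-Solver
      regroup : 2 ℕ.* p ℕ.* (C ℕ.* M) ≡ p ℕ.* (2 ℕ.* C) ℕ.* M
      regroup = solve 3 (λ p c m → con 2 :* p :* (c :* m) := p :* (con 2 :* c) :* m) ≡.refl p C M

    module _ {κ} (sκ≈1 : s * κ ≈ 1#) (0<ε : 0# < ε) where

      -- For `ε` at most `κ` the product `s * ε` is at most 1, so `p = q = 1` is admissible above.
      2≤M : ε ≤ κ → 2 ℕ.≤ M
      2≤M ε≤κ = ≡.subst (2 ℕ.≤_) (ℕ.*-identityˡ M) (doubled-bound 1 1 (begin
        fromNat 1 * (s * ε)
          ≤⟨ *-monoˡ (fromNat-nonNegative 1) (*-monoˡ (fromNat-nonNegative (2 ℕ.* C)) ε≤κ) ⟩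
        fromNat 1 * (s * κ)   ≈⟨ *-congˡ sκ≈1 ⟩
        fromNat 1 * 1#        ≈⟨ *-identityʳ _ ⟩
        fromNat 1             ∎))

      κ/ε-bound : ∀ p q → fromNat p ≤ fromNat q * (κ / ε) → 2 ℕ.* p ℕ.≤ q ℕ.* M
      κ/ε-bound p q p≤qκ/ε = doubled-bound p q (begin
        fromNat p * (s * ε)
          ≤⟨ *-monoʳ (*-nonNegative (fromNat-nonNegative (2 ℕ.* C)) (proj₁ 0<ε)) p≤qκ/ε ⟩
        fromNat q * (κ * ε ⁻¹) * (s * ε)      ≈⟨ *-assoc _ _ _ ⟩
        fromNat q * (κ * ε ⁻¹ * (s * ε))      ≈⟨ *-congˡ (interchange κ (ε ⁻¹) s ε) ⟩
        fromNat q * (κ * s * (ε ⁻¹ * ε))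
          ≈⟨ *-congˡ (*-cong (trans (*-comm κ s) sκ≈1) (⁻¹-inverseˡ (proj₂ 0<ε ∘ sym))) ⟩
        fromNat q * (1# * 1#)                 ≈⟨ *-congˡ (*-identityˡ 1#) ⟩
        fromNat q * 1#                        ≈⟨ *-identityʳ _ ⟩
        fromNat q                             ∎)

  complexity-bound : ∀ j {κ} → fromNat (2 ℕ.* slope j) * κ ≈ 1# →
    ∀ m → suc j ℕ.≤ m → ∀ ε → 0# < ε → ε ≤ κ →
    CardinalComplexity≥ K m ε (twos j (fromField K (κ / ε)))
  complexity-bound j {κ} sκ≈1 m j<m ε 0<ε ε≤κ N feasible
    with tower-bracket j N N (ℕ.≤-trans (ℕ.n≤1+n N) (M≤tower j (suc N)))
  ... | L , N≤ , located = located-bound located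
    where
    M = suc L
    1≤denominator = ℕ.≤-trans (s≤s z≤n) (M≤denominator j M)
    1≤CMε : 1# ≤ fromNat (slope j ℕ.* M) * ε
    1≤CMε = ≤-trans (Guess.feasible-bound (tower-beats j M) j<m N≤ 1≤denominator feasible)
      (*-monoʳ (proj₁ 0<ε) (fromNat-mono (denominator≤ j (s≤s z≤n))))
    1≤L : 1 ℕ.≤ L
    -- The smallness of `ε` excludes the degenerate bracket `L ≡ 0`, where no lower bound on `N` is
    -- known.
    1≤L = ℕ.≤-pred (2≤M (slope j) M 1≤CMε sκ≈1 0<ε ε≤κ)
    κ/ε≤L : fromField K (κ / ε) ≤ℕ L
    κ/ε≤L p q (p≤ , _) = halve p q 1≤L (κ/ε-bound (slope j) M 1≤CMε sκ≈1 0<ε p (suc q) p≤)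
    located-bound : L ≡ 0 ⊎ tower j L ℕ.≤ N → twos j (fromField K (κ / ε)) ≤ℕ N
    located-bound (inj₁ L≡0)   = contradiction L≡0 (ℕ.n>0⇒n≢0 1≤L)
    located-bound (inj₂ tower≤N) p q below =
      ℕ.≤-trans (twos-≤ℕ j {fromField K (κ / ε)} {L} κ/ε≤L p q below) (ℕ.*-monoˡ-≤ (suc q) tower≤N)

1≤slope : ∀ j → 1 ℕ.≤ slope j
1≤slope zero          = s≤s z≤n
1≤slope (suc zero)    = s≤s z≤n
1≤slope (suc (suc j)) = ℕ.≤-trans (1≤slope (suc j)) (ℕ.m≤n+m _ _)

corollary4p2 : ∀ {a ℓ₁ ℓ₂ : Level} (K : ArchimedeanOrderedField a ℓ₁ ℓ₂) →
    let open ArchimedeanOrderedField K in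
    ∀ (c : ℕ) → 2 ≤ⁿ c →
    Σ[ κ ∈ Carrier ] Σ[ ε₀ ∈ Carrier ] (0# < κ) × (0# < ε₀) ×
    (∀ (m : ℕ) → c ≤ⁿ suc m →
    ∀ (ε : Carrier) → 0# < ε → ε ≤ ε₀ →
    CardinalComplexity≥ K m ε (twos (c ∸ 2) (fromField K (κ / ε))))
corollary4p2 K (suc (suc j)) (s≤s (s≤s z≤n)) =
  -- The threshold for `ε` is `κ` itself. The factor 2 in its inverse is the one that `halve`
  -- spends.
  κ , κ , 0<κ , 0<κ , λ m c≤n → complexity-bound K j (⁻¹-inverseʳ s≉0) m (ℕ.≤-pred c≤n)
  where
  open ArchimedeanOrderedField K
  s κ : Carrier
  s = fromNat (2 ℕ.* slope j)
  κ = s ⁻¹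
  s≉0 : ¬ s ≈ 0#
  s≉0 = fromNat≉0 K (ℕ.≤-trans (1≤slope j) (ℕ.m≤n*m (slope j) 2))
  0<κ : 0# < κ
  0<κ = ⁻¹-nonNegative K s≉0 (fromNat-nonNegative K (2 ℕ.* slope j)) , ⁻¹≉0 K s≉0 ∘ sym
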